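{- Under the assumptions below, the coherent configuration $\mathcal{X}'$ also satisfies $|S'_k|>6c(k-1)$. Moreover, given points $\alpha\in \Omega$ and $\alpha'\in\Omega'$, the mapping $$\varphi_{\alpha,\alpha'}:M_{\alpha}\to M'_{\alpha'},\quad r_{x,y}\mapsto r'_{x',y'}$$ is an algebraic isomorphism from $\mathcal{M}_\alpha=(\Delta_\alpha,M_\alpha)$ to $\mathcal{M}'_{\alpha'}=(\Delta'_{\alpha'},M'_{\alpha'})$. Moreover, if $a\in M_\alpha$ and $a\subset r\in S$, then $a^{\varphi_{\alpha,\alpha'}}\subset r^\varphi$.
   Context: Let $\mathcal{X}=(\Omega,S)$ be a homogeneous coherent configuration (scheme) with maximum valency $k>1$ and indistinguishing number $c$ (the maximum over non-reflexive basis relations $r$ of $c(r)=\sum_{s\in S}c_{ss^*}^r$, equivalently $|\{\gamma:\ r(\gamma,\alpha)=r(\gamma,\beta)\}|$ for $(\alpha,\beta)\in r$). Let $S_k$ be the set of basis relations of valency $k$, and assume $|S_k|>6c(k-1)$. Let $\varphi:\mathcal{X}\to\mathcal{X}'$, $r\mapsto r'$, be an algebraic isomorphism (a bijection $S\to S'$ preserving all intersection numbers $c_{rs}^t=c_{r's'}^{t'}$) onto an arbitrary coherent configuration $\mathcal{X}'=(\Omega',S')$; for $x\in S$ write $x'=x^\varphi$. For $x,y\in S_k$, write $x\sim y$ iff $x^*y$ (the set of basis relations contained in the relation product $x^*\cdot y$) has exactly $k$ elements. For a point $\alpha$ and $r,x,y\in S$, set $r_{x,y}=r\cap(\alpha x\times\alpha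 y)$, where $\alpha x=\{\beta:(\alpha,\beta)\in x\}$. Define $\Delta_\alpha=\alpha S_k=\bigcup_{x\in S_k}\alpha x$ and $M_\alpha=\bigcup_{x,y\in S_k}M_\alpha(x,y)$, where $M_\alpha(x,y)=\{r_{x,y}:\ r\in x^*y\}$ if $x\sim y$; $M_\alpha(x,y)=\varnothing$ if $x\not\sim y$ and $x\ne y$; and $M_\alpha(x,y)=\{1_{\alpha x}\}$ (the diagonal of $\alpha x$) if $x\not\sim y$ and $x=y$. Under the hypothesis $|S_k|>6c(k-1)$, $\mathcal{M}_\alpha=(\Delta_\alpha,M_\alpha)$ is a partial coherent configuration (indeed a saturated matching configuration). The objects $\sim$, $r'_{x',y'}$, $\Delta'_{\alpha'}$, $M'_{\alpha'}$, $\mathcal{M}'_{\alpha'}$ are defined in the same way for $\mathcal{X}'$, with $S'_k$ and the point $\alpha'$. -}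

module Defs where

open import Data.Nat using (ℕ; zero; suc; _+_; _*_; _∸_; _<_; _⊔_; _≡ᵇ_)
open import Data.Fin using (Fin; zero; suc) renaming (_≟_ to _≟F_)
open import Data.Bool using (Bool; true; false; _∧_; _∨_; not; if_then_else_; T)
open import Data.Product using (Σ; _×_; _,_)
open import Data.Sum using (_⊎_; inj₁; inj₂)
open import Function using (_∘_)
open import Function.Bundles using (Bijection; _⤖_)
open import Relation.Nullary.Decidable using (isYes)
open import Relation.Binary.PropositionalEquality using (_≡_)

_==_ : ∀ {n} → Fin n → Fin n → Bool
x == y = isYes (x ≟F y)

anyF : ∀ {n} → (Fin n → Bool) → Bool
anyF {zero}  p = false
anyF {suc n} p = p zero ∨ anyF (p ∘ suc)

allF : ∀ {n} → (Fin n → Bool) → Bool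
allF {zero}  p = true
allF {suc n} p = p zero ∧ allF (p ∘ suc)

#_ : ∀ {n} → (Fin n → Bool) → ℕ
#_ {zero}  p = 0
#_ {suc n} p = (if p zero then 1 else 0) + # (p ∘ suc)

sumF : ∀ {n} → (Fin n → ℕ) → ℕ
sumF {zero}  f = 0
sumF {suc n} f = f zero + sumF (f ∘ suc)

maxF : ∀ {n} → (Fin n → ℕ) → ℕ
maxF {zero}  f = 0
maxF {suc n} f = f zero ⊔ maxF (f ∘ suc)

-- Coherent configuration on Ω = Fin n with basis relations indexed by
-- colours Fin m: the basis relation of colour r is {(α,β) : col α β ≡ r}.

record CC (n m : ℕ) : Set where
  field
    col      : Fin n → Fin n → Fin m
    nonempty : ∀ r → Σ (Fin n) λ α → Σ (Fin n) λ β → col α β ≡ r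
    -- the diagonal 1_Ω is a union of basis relations
    diag     : ∀ α β γ → col β γ ≡ col α α → β ≡ γ
    tr       : Fin m → Fin m
    tr-spec  : ∀ α β → col β α ≡ tr (col α β)
    isn      : Fin m → Fin m → Fin m → ℕ
    isn-spec : ∀ r s t α β → col α β ≡ t →
               # (λ γ → (col α γ == r) ∧ (col γ β == s)) ≡ isn r s t

Homogeneous : ∀ {n m} → CC n m → Set
Homogeneous X = ∀ α β → col α α ≡ col β β
  where open CC X

record AlgIso {n m n' m'} (X : CC n m) (X' : CC n' m') : Set where
  field
    φ    : Fin m ⤖ Fin m'
  _′ : Fin m → Fin m'
  _′ = Bijection.to φ
  field
    pres : ∀ r s t → CC.isn X r s t ≡ CC.isn X' (r ′) (s ′) (t ′)

module Params {n m} (X : CC n m) where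
  open CC X

  val : Fin n → Fin m → ℕ
  val α r = # (λ β → col α β == r)

  -- valency of r (|αr| for α in the domain of r)
  valOf : Fin m → ℕ
  valOf r = maxF (λ α → val α r)

  maxVal : ℕ
  maxVal = maxF valOf

  inSk : Fin m → Bool
  inSk r = valOf r ≡ᵇ maxVal

  sizeSk : ℕ
  sizeSk = # inSk

  -- r ∈ x*y, i.e. r meets the relation product x*·y
  prodB : Fin m → Fin m → Fin m → Bool
  prodB x y r = anyF λ α → anyF λ β → anyF λ γ →
                (col α β == x) ∧ (col α γ == y) ∧ (col β γ == r)

  sim : Fin m → Fin m → Bool
  sim x y = # (prodB x y) ≡ᵇ maxVal

  reflB : Fin m → Bool
  reflB r = allF λ α → allF λ β → not (col α β == r) ∨ (α == β)

  cOf : Fin m → ℕ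
  cOf r = sumF (λ s → isn s (tr s) r)

  indist : ℕ
  indist = maxF (λ r → if reflB r then 0 else cOf r)

  Condition : Set
  Condition = 6 * indist * (maxVal ∸ 1) < sizeSk

  -- The configuration M_α: its relations are indexed by labels
  --   inj₁ (x,y,r) : r_{x,y} with x,y ∈ S_k, x ∼ y, r ∈ x*y
  --   inj₂ x       : 1_{αx}  with x ∈ S_k, x ≁ x

  Label : Set
  Label = (Σ (Fin m × Fin m × Fin m) λ { (x , y , r) →
             T (inSk x ∧ inSk y ∧ sim x y ∧ prodB x y r) })
          ⊎ (Σ (Fin m) λ x → T (inSk x ∧ not (sim x x)))

  underlying : Label → (Fin m × Fin m × Fin m) ⊎ Fin m
  underlying (inj₁ (t , _)) = inj₁ t
  underlying (inj₂ (x , _)) = inj₂ x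

  mrel : Fin n → Label → Fin n → Fin n → Bool
  mrel α (inj₁ ((x , y , r) , _)) β γ = (col α β == x) ∧ (col α γ == y) ∧ (col β γ == r)
  mrel α (inj₂ (x , _))            β γ = (col α β == x) ∧ (β == γ)

  mcount : Fin n → Label → Label → Fin n → Fin n → ℕ
  mcount α a b β δ = # (λ γ → mrel α a β γ ∧ mrel α b γ δ)

open Params public

liftφ : ∀ {m m'} → (Fin m → Fin m') →
        (Fin m × Fin m × Fin m) ⊎ Fin m → (Fin m' × Fin m' × Fin m') ⊎ Fin m'
liftφ f (inj₁ (x , y , r)) = inj₁ (f x , f y , f r)
liftφ f (inj₂ x)           = inj₂ (f x)

IsMIso : ∀ {n m n' m'} (X : CC n m) (X' : CC n' m') (α : Fin n) (α' : Fin n') →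
         Label X ⤖ Label X' → Set
IsMIso X X' α α' f =
  ∀ a b d β δ β' δ' → T (mrel X α d β δ) → T (mrel X' α' (F d) β' δ') →
  mcount X α a b β δ ≡ mcount X' α' (F a) (F b) β' δ'
  where F = Bijection.to f

{-# OPTIONS --safe #-}
module Submission where

open import Defs
open import Data.Nat using (ℕ; zero; suc; _+_; _*_; _∸_; _≡ᵇ_; _≤_; _<_; z≤n; s≤s; >-nonZero)
open import Data.Nat.Properties
open import Data.Nat.Tactic.RingSolver using (solve-∀)
open import Data.Fin using (Fin; zero; suc) renaming (_≟_ to _≟F_)
open import Data.Bool using (Bool; true; false; _∧_; _∨_; not; if_then_else_; T)
open import Data.Bool.Properties using (T-∧; T-irrelevant)
open import Data.Empty using (⊥-elim)
open import Data.Product using (Σ; ∃; _×_; _,_; proj₁; proj₂)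
open import Data.Sum using (inj₁; inj₂)
open import Data.Sum.Properties using (inj₁-injective; inj₂-injective)
open import Data.Unit using (tt)
open import Function using (_∘_)
open import Function.Bundles using (Bijection; _⤖_; mk⤖; module Equivalence)
open import Function.Construct.Identity using (⤖-id)
open import Relation.Nullary using (¬_; yes; no)
open import Relation.Nullary.Decidable using (toWitness; fromWitness)
open import Relation.Binary.PropositionalEquality

-- Fix a tetrahedron α β γ δ.  Call a fifth point ω good for the edge βγ (seen from α) if
-- the colour of βγ is the only element of x*y ∩ pq*, where x, y are the colours of αβ, αγ
-- and p, q those of βω, γω.  A double count that uses the indistinguishing number c shows
-- that at most ck(k − 1) points ω are bad for one edge, and n ≥ k|S_k| > 6ck(k − 1), so some
-- ω is good for βγ, βδ and γδ together.  Now transport along φ: given α′β′ of the colour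
-- corresponding to αβ, find ω′ over αβ, then γ′ and δ′ over α′ω′.  Goodness forces
-- β′γ′, β′δ′, γ′δ′ to have the corresponding colours, as in the proof of Desargues' theorem
-- by lifting out of the plane.  The relations of M_α are partial matchings, so its
-- intersection numbers are 0 or 1 and are determined by which tetrahedra over α exist.

private variable
  m n m′ n′ : ℕ

-- Boolean reflection and finite quantifiers.

T-antisym : ∀ {a b} → (T a → T b) → (T b → T a) → a ≡ b
T-antisym {false} {false} f g = refl
T-antisym {false} {true}  f g = ⊥-elim (g tt)
T-antisym {true}  {false} f g = ⊥-elim (f tt)
T-antisym {true}  {true}  f g = refl

T-not⁺ : ∀ {b} → ¬ T b → T (not b)
T-not⁺ {false} ¬b = tt
T-not⁺ {true}  ¬b = ¬b tt

T-not⁻ : ∀ {b} → T (not b) → ¬ T b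
T-not⁻ {false} _ ()

∧⁺ : ∀ {a b} → T a → T b → T (a ∧ b)
∧⁺ p q = Equivalence.from T-∧ (p , q)

∧⁻ : ∀ {a b} → T (a ∧ b) → T a × T b
∧⁻ = Equivalence.to T-∧

==⇒≡ : ∀ {i j : Fin n} → T (i == j) → i ≡ j
==⇒≡ = toWitness

≡⇒== : ∀ {i j : Fin n} → i ≡ j → T (i == j)
≡⇒== = fromWitness

==-cong : ∀ {i j : Fin n} {k l : Fin m} → (i ≡ j → k ≡ l) → (k ≡ l → i ≡ j) → (i == j) ≡ (k == l)
==-cong f g = T-antisym (≡⇒== ∘ f ∘ ==⇒≡) (≡⇒== ∘ g ∘ ==⇒≡)

anyF⁺ : (p : Fin n → Bool) (i : Fin n) → T (p i) → T (anyF p)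
anyF⁺ p zero    pi with true ← p zero = tt
anyF⁺ p (suc i) pi with p zero
... | true  = tt
... | false = anyF⁺ (p ∘ suc) i pi

anyF⁻ : (p : Fin n → Bool) → T (anyF p) → ∃ λ i → T (p i)
anyF⁻ {suc n} p h with p zero in eq
... | true  = zero , subst T (sym eq) tt
... | false with i , pi ← anyF⁻ (p ∘ suc) h = suc i , pi

allF⁺ : (p : Fin n → Bool) → (∀ i → T (p i)) → T (allF p)
allF⁺ {zero}  p h = tt
allF⁺ {suc n} p h = ∧⁺ (h zero) (allF⁺ (p ∘ suc) (h ∘ suc))

allF⁻ : (p : Fin n → Bool) → T (allF p) → ∀ i → T (p i)
allF⁻ p h zero    = proj₁ (∧⁻ h)
allF⁻ p h (suc i) = allF⁻ (p ∘ suc) (proj₂ (∧⁻ {p zero} h)) i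

-- Finite sums and indicator functions.

ι : Bool → ℕ
ι b = if b then 1 else 0

δ : Fin n → Fin n → ℕ
δ i j = ι (i == j)

ι≤1 : ∀ b → ι b ≤ 1
ι≤1 true  = s≤s z≤n
ι≤1 false = z≤n

ι-true : ∀ {b} → T b → ι b ≡ 1
ι-true {true} _ = refl

ι-∧ : ∀ a b → ι (a ∧ b) ≡ ι a * ι b
ι-∧ true  b = sym (*-identityˡ (ι b))
ι-∧ false b = refl

ι-idem : ∀ b → ι b * ι b ≡ ι b
ι-idem true  = refl
ι-idem false = refl

ι*-cong : ∀ b {x y} → (T b → x ≡ y) → ι b * x ≡ ι b * y
ι*-cong true  h = cong (1 *_) (h tt)
ι*-cong false h = refl

ι*-mono : ∀ b {x y} → (T b → x ≤ y) → ι b * x ≤ ι b * y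
ι*-mono true  h = *-monoʳ-≤ 1 (h tt)
ι*-mono false h = z≤n

sum-cong : {f g : Fin n → ℕ} → (∀ i → f i ≡ g i) → sumF f ≡ sumF g
sum-cong {zero}  h = refl
sum-cong {suc n} h = cong₂ _+_ (h zero) (sum-cong (h ∘ suc))

sum-mono-≤ : {f g : Fin n → ℕ} → (∀ i → f i ≤ g i) → sumF f ≤ sumF g
sum-mono-≤ {zero}  h = z≤n
sum-mono-≤ {suc n} h = +-mono-≤ (h zero) (sum-mono-≤ (h ∘ suc))

sum-mono-< : {f g : Fin n → ℕ} → (∀ i → f i ≤ g i) → ∀ i → f i < g i → sumF f < sumF g
sum-mono-< h zero    fi<gi = +-mono-<-≤ fi<gi (sum-mono-≤ (h ∘ suc))
sum-mono-< h (suc i) fi<gi = +-mono-≤-< (h zero) (sum-mono-< (h ∘ suc) i fi<gi)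

sum-zero : ∀ n → sumF {n} (λ _ → 0) ≡ 0
sum-zero zero    = refl
sum-zero (suc n) = sum-zero n

sum-one : ∀ n → sumF {n} (λ _ → 1) ≡ n
sum-one zero    = refl
sum-one (suc n) = cong suc (sum-one n)

sum-+ : (f g : Fin n → ℕ) → sumF (λ i → f i + g i) ≡ sumF f + sumF g
sum-+ {zero}  f g = refl
sum-+ {suc n} f g = trans (cong (f zero + g zero +_) (sum-+ (f ∘ suc) (g ∘ suc)))
                          (interchange (f zero) (g zero) _ _)
  where
  interchange : ∀ a b c d → a + b + (c + d) ≡ a + c + (b + d)
  interchange = solve-∀

sum-*ˡ : ∀ c (f : Fin n → ℕ) → sumF (λ i → c * f i) ≡ c * sumF f
sum-*ˡ {zero}  c f = sym (*-zeroʳ c)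
sum-*ˡ {suc n} c f = trans (cong (c * f zero +_) (sum-*ˡ c (f ∘ suc))) (sym (*-distribˡ-+ c _ _))

sum-*ʳ : ∀ (f : Fin n → ℕ) c → sumF (λ i → f i * c) ≡ sumF f * c
sum-*ʳ f c = trans (sum-cong (λ i → *-comm (f i) c)) (trans (sum-*ˡ c f) (*-comm c _))

sum-swap : (f : Fin m → Fin n → ℕ) →
           sumF (λ i → sumF (λ j → f i j)) ≡ sumF (λ j → sumF (λ i → f i j))
sum-swap {zero}  {n} f = sym (sum-zero n)
sum-swap {suc m}     f = trans (cong (sumF (f zero) +_) (sum-swap (f ∘ suc))) (sym (sum-+ (f zero) _))

sum₂-swap : (f : Fin m → Fin m → Fin n → Fin n → ℕ) →
            sumF (λ i → sumF λ j → sumF λ k → sumF λ l → f i j k l) ≡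
            sumF (λ k → sumF λ l → sumF λ i → sumF λ j → f i j k l)
sum₂-swap f =
  trans (sum-cong λ i → trans (sum-swap λ j k → sumF λ l → f i j k l)
                              (sum-cong λ k → sum-swap λ j l → f i j k l))
 (trans (sum-swap λ i k → sumF λ l → sumF λ j → f i j k l)
        (sum-cong λ k → sum-swap λ i l → sumF λ j → f i j k l))

δ-sift : (i : Fin n) (f : Fin n → ℕ) → sumF (λ j → δ i j * f j) ≡ f i
δ-sift {suc n} zero    f =
  trans (cong₂ _+_ (*-identityˡ (f zero)) (sum-zero n)) (+-identityʳ (f zero))
δ-sift {suc n} (suc i) f =
  trans (sum-cong λ j → cong (λ b → ι b * f (suc j)) (==-cong {i = suc i} {suc j} {i} {j} (λ { refl → refl }) (cong suc)))
        (δ-sift i (f ∘ suc))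

-- Groups the indices by their value under `g`. With `g` a colour function this trades a sum over
-- points for a sum over colours, where intersection numbers appear.
sum-fibres : (u : Fin n → ℕ) (g : Fin n → Fin m) (K : Fin m → ℕ) →
             sumF (λ i → u i * K (g i)) ≡ sumF (λ q → sumF (λ i → u i * δ (g i) q) * K q)
sum-fibres u g K = begin
  sumF (λ i → u i * K (g i))
    ≡⟨ sum-cong (λ i → cong (u i *_) (sym (δ-sift (g i) K))) ⟩
  sumF (λ i → u i * sumF (λ q → δ (g i) q * K q))
    ≡⟨ sum-cong (λ i → trans (sym (sum-*ˡ (u i) λ q → δ (g i) q * K q)) (sum-cong λ q → sym (*-assoc (u i) (δ (g i) q) (K q)))) ⟩
  sumF (λ i → sumF (λ q → u i * δ (g i) q * K q))
    ≡⟨ sum-swap (λ i q → u i * δ (g i) q * K q) ⟩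
  sumF (λ q → sumF (λ i → u i * δ (g i) q * K q))
    ≡⟨ sum-cong (λ q → sum-*ʳ (λ i → u i * δ (g i) q) (K q)) ⟩
  sumF (λ q → sumF (λ i → u i * δ (g i) q) * K q) ∎
  where open ≡-Reasoning

-- Pigeonhole: `n` positive terms would add up to at least `n`.
sum<n⇒zero : (f : Fin n → ℕ) → sumF f < n → ∃ λ i → f i ≡ 0
sum<n⇒zero {suc n} f h with f zero in eq
... | zero  = zero , eq
... | suc k with i , fi≡0 ← sum<n⇒zero (f ∘ suc) (≤-<-trans (m≤n+m _ k) (≤-pred h)) = suc i , fi≡0

term≤sum : (f : Fin n → ℕ) → ∀ i → f i ≤ sumF f
term≤sum f zero    = m≤m+n _ _
term≤sum f (suc i) = ≤-trans (term≤sum (f ∘ suc) i) (m≤n+m _ _)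

-- Counts and maxima.

#-sum : (p : Fin n → Bool) → # p ≡ sumF (ι ∘ p)
#-sum {zero}  p = refl
#-sum {suc n} p = cong (ι (p zero) +_) (#-sum (p ∘ suc))

#⁺ : (p : Fin n → Bool) → ∀ i → T (p i) → 0 < # p
#⁺ p i pi = subst (0 <_) (sym (#-sum p))
  (≤-trans (≤-reflexive (sym (ι-true pi))) (term≤sum (ι ∘ p) i))

#⁻ : (p : Fin n → Bool) → 0 < # p → ∃ λ i → T (p i)
#⁻ {suc n} p h with p zero in eq
... | true  = zero , subst T (sym eq) tt
... | false with i , pi ← #⁻ (p ∘ suc) h = suc i , pi

#≤1 : (p : Fin n → Bool) → (∀ i j → T (p i) → T (p j) → i ≡ j) → # p ≤ 1
#≤1 {n} p unique with # p in eq
... | zero  = z≤n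
... | suc _ with i , pi ← #⁻ p (subst (0 <_) (sym eq) (s≤s z≤n)) = begin
  _                           ≡⟨ sym eq ⟩
  # p                         ≡⟨ #-sum p ⟩
  sumF (ι ∘ p)                ≤⟨ sum-mono-≤ bound ⟩
  sumF (λ j → δ i j * 1)      ≡⟨ δ-sift i (λ _ → 1) ⟩
  1                           ∎
  where
  open ≤-Reasoning
  bound : ∀ j → ι (p j) ≤ δ i j * 1
  bound j with p j in pj
  ... | false = z≤n
  ... | true  = ≤-reflexive (sym (cong (_* 1) (ι-true {i == j} (≡⇒== (unique i j pi (subst T (sym pj) tt))))))

1<# : (p : Fin n → Bool) → ∀ i j → i ≢ j → T (p i) → T (p j) → 1 < # p
1<# p i j i≢j pi pj = begin-strict
  1                      ≡⟨ sym (δ-sift i (λ _ → 1)) ⟩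
  sumF (λ l → δ i l * 1) <⟨ sum-mono-< bound j strictAt ⟩
  sumF (ι ∘ p)           ≡⟨ sym (#-sum p) ⟩
  # p                    ∎
  where
  open ≤-Reasoning
  bound : ∀ l → δ i l * 1 ≤ ι (p l)
  bound l with i ≟F l
  ... | no _     = z≤n
  ... | yes refl = ≤-reflexive (sym (ι-true pi))
  strictAt : δ i j * 1 < ι (p j)
  strictAt with i ≟F j
  ... | no _    = ≤-reflexive (sym (ι-true pj))
  ... | yes i≡j = ⊥-elim (i≢j i≡j)

≤1-antisym : ∀ {a b} → a ≤ 1 → b ≤ 1 → (0 < a → 0 < b) → (0 < b → 0 < a) → a ≡ b
≤1-antisym {zero}        {zero}        _ _ f g = refl
≤1-antisym {zero}        {suc _}       _ _ f g with () ← g (s≤s z≤n)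
≤1-antisym {suc _}       {zero}        _ _ f g with () ← f (s≤s z≤n)
≤1-antisym {suc zero}    {suc zero}    _ _ f g = refl
≤1-antisym {suc (suc _)} (s≤s ())
≤1-antisym {suc zero}    {suc (suc _)} _ (s≤s ())

max-upper : (f : Fin n → ℕ) → ∀ i → f i ≤ maxF f
max-upper f zero    = m≤m⊔n _ _
max-upper f (suc i) = ≤-trans (max-upper (f ∘ suc) i) (m≤n⊔m _ _)

max-least : (f : Fin n → ℕ) {b : ℕ} → (∀ i → f i ≤ b) → maxF f ≤ b
max-least {zero}  f h = z≤n
max-least {suc n} f h = ⊔-lub (h zero) (max-least (f ∘ suc) (h ∘ suc))

-- Sums, counts and maxima along a bijection.

module Reindex (e : Fin m ⤖ Fin m′) where
  open Bijection e using (to; injective; strictlySurjective)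

  sum-reindex : {f : Fin m → ℕ} {g : Fin m′ → ℕ} → (∀ i → g (to i) ≡ f i) → sumF f ≡ sumF g
  sum-reindex {f} {g} h = begin
    sumF f
      ≡⟨ sum-cong (λ i → trans (sym (h i)) (sym (*-identityˡ _))) ⟩
    sumF (λ i → 1 * g (to i))
      ≡⟨ sum-fibres (λ _ → 1) to g ⟩
    sumF (λ j → sumF (λ i → 1 * δ (to i) j) * g j)
      ≡⟨ sum-cong (λ j → trans (cong (_* g j) (fibre j)) (*-identityˡ _)) ⟩
    sumF g ∎
    where
    open ≡-Reasoning
    fibre : ∀ j → sumF (λ i → 1 * δ (to i) j) ≡ 1
    fibre j with i , refl ← strictlySurjective j =
      trans (sum-cong λ l → trans (*-comm 1 _) (cong (λ b → ι b * 1)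
              (==-cong {i = to l} {to i} {i} {l} (sym ∘ injective) (cong to ∘ sym))))
            (δ-sift i (λ _ → 1))

  #-reindex : {p : Fin m → Bool} {q : Fin m′ → Bool} → (∀ i → q (to i) ≡ p i) → # p ≡ # q
  #-reindex {p} {q} h = trans (#-sum p) (trans (sum-reindex (cong ι ∘ h)) (sym (#-sum q)))

  max-reindex : {f : Fin m → ℕ} {g : Fin m′ → ℕ} → (∀ i → g (to i) ≡ f i) → maxF f ≡ maxF g
  max-reindex {f} {g} h = ≤-antisym
    (max-least f λ i → ≤-trans (≤-reflexive (sym (h i))) (max-upper g (to i)))
    (max-least g λ j → let i , eq = strictlySurjective j in
      ≤-trans (≤-reflexive (trans (cong g (sym eq)) (h i))) (max-upper f i))

-- Valencies and double counts in a homogeneous scheme.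

module Scheme {n m} (X : CC n m) (homogeneous : Homogeneous X) where
  open CC X

  tr-involutive : ∀ r → tr (tr r) ≡ r
  tr-involutive r with nonempty r
  ... | α , β , refl = trans (cong tr (sym (tr-spec α β))) (sym (tr-spec β α))

  isn-sum : ∀ r s α β → isn r s (col α β) ≡ sumF λ γ → δ (col α γ) r * δ (col γ β) s
  isn-sum r s α β = trans (sym (isn-spec r s _ α β refl))
    (trans (#-sum λ γ → (col α γ == r) ∧ (col γ β == s)) (sum-cong λ γ → ι-∧ (col α γ == r) (col γ β == s)))

  -- The second edge is read backwards, so that both edges end at `γ` and the transpose disappears
  -- from the sum.
  isn-tr-sum : ∀ r s α β → isn r (tr s) (col α β) ≡ sumF λ γ → δ (col α γ) r * δ (col β γ) s
  isn-tr-sum r s α β = trans (isn-sum r (tr s) α β) (sum-cong λ γ → cong (λ b → δ (col α γ) r * ι b)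
    (==-cong (λ eq → trans (tr-spec γ β) (trans (cong tr eq) (tr-involutive s)))
             (λ eq → trans (tr-spec β γ) (cong tr eq))))

  val-sum : ∀ α r → val X α r ≡ sumF λ β → δ (col α β) r
  val-sum α r = #-sum (λ β → col α β == r)

  -- A point `β` of `α r` is a closed path `α β α` with colours `r` and `tr r`. So the valency
  -- depends on `α` only through the colour of its loop.
  val-isn : ∀ α r → val X α r ≡ isn r (tr r) (col α α)
  val-isn α r = trans (val-sum α r)
    (trans (sum-cong λ β → sym (ι-idem (col α β == r))) (sym (isn-tr-sum r r α α)))

  val-constant : ∀ α β r → val X α r ≡ val X β r
  val-constant α β r = trans (val-isn α r)
    (trans (cong (isn r (tr r)) (homogeneous α β)) (sym (val-isn β r)))

  valOf≡val : ∀ α r → valOf X r ≡ val X α r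
  valOf≡val α r = ≤-antisym (max-least _ λ β → ≤-reflexive (val-constant β α r)) (max-upper (λ β → val X β r) α)

  val≤maxVal : ∀ α r → val X α r ≤ maxVal X
  val≤maxVal α r = ≤-trans (≤-reflexive (sym (valOf≡val α r))) (max-upper (valOf X) r)

  val-inSk : ∀ α r → T (inSk X r) → val X α r ≡ maxVal X
  val-inSk α r r∈Sk = trans (sym (valOf≡val α r)) (≡ᵇ⇒≡ _ _ r∈Sk)

  reflB⁺ : ∀ α r → r ≡ col α α → T (reflB X r)
  reflB⁺ α r r≡1 = allF⁺ _ λ β → allF⁺ _ λ γ → body β γ
    where
    body : ∀ β γ → T ((not (col β γ == r)) ∨ (β == γ))
    body β γ with col β γ ≟F r
    ... | no _  = tt
    ... | yes q = ≡⇒== (diag α β γ (trans q r≡1))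

  reflB⁻ : ∀ α β → T (reflB X (col α β)) → α ≡ β
  reflB⁻ α β h with col α β ≟F col α β | allF⁻ _ (allF⁻ _ h α) β
  ... | yes _ | q = ==⇒≡ q
  ... | no ≢  | _ = ⊥-elim (≢ refl)

  -- Each `ω` can contribute only for `s = col γ ω`, so the sum counts the points joined to `γ` and
  -- `γ′` by the same colour.
  cOf-sum : ∀ γ γ′ → cOf X (col γ γ′) ≡ sumF λ ω → δ (col γ′ ω) (col γ ω)
  cOf-sum γ γ′ = begin
    sumF (λ s → isn s (tr s) (col γ γ′))
      ≡⟨ sum-cong (λ s → isn-tr-sum s s γ γ′) ⟩
    sumF (λ s → sumF λ ω → δ (col γ ω) s * δ (col γ′ ω) s)
      ≡⟨ sum-swap (λ s ω → δ (col γ ω) s * δ (col γ′ ω) s) ⟩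
    sumF (λ ω → sumF λ s → δ (col γ ω) s * δ (col γ′ ω) s)
      ≡⟨ sum-cong (λ ω → δ-sift (col γ ω) (δ (col γ′ ω))) ⟩
    sumF (λ ω → δ (col γ′ ω) (col γ ω)) ∎
    where open ≡-Reasoning

  cOf≤indist : ∀ γ γ′ → γ ≢ γ′ → cOf X (col γ γ′) ≤ indist X
  cOf≤indist γ γ′ γ≢γ′ with reflB X (col γ γ′) in eq | max-upper (λ r → if reflB X r then 0 else cOf X r) (col γ γ′)
  ... | true  | _ = ⊥-elim (γ≢γ′ (reflB⁻ γ γ′ (subst T (sym eq) tt)))
  ... | false | h = h

  -- Pairs `(ω , ω′)` such that the cone from `ω` over `β γ` and the cone from `ω′` over `β γ′`
  -- carry the same colours, and so cannot tell the two base edges apart.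
  confusion : (β γ γ′ : Fin n) → ℕ
  confusion β γ γ′ = sumF λ ω → sumF λ ω′ → δ (col β ω′) (col β ω) * δ (col γ′ ω′) (col γ ω)

  -- Grouping by `q = col γ ω` and `p = col β ω` leaves only intersection numbers. Hence `γ` and
  -- `γ′` matter only through their colours from `β`, which permits averaging over both.
  confusion-isn : ∀ β γ γ′ → confusion β γ γ′ ≡
    sumF λ q → sumF λ p → isn q (tr p) (tr (col β γ)) * isn p (tr q) (col β γ′)
  confusion-isn β γ γ′ = begin
    confusion β γ γ′
      ≡⟨ sum-cong (λ ω → sym (isn-tr-sum (col β ω) (col γ ω) β γ′)) ⟩
    sumF (λ ω → isn (col β ω) (tr (col γ ω)) r′)
      ≡⟨ sum-cong (λ ω → sym (δ-sift (col γ ω) λ q → isn (col β ω) (tr q) r′)) ⟩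
    sumF (λ ω → sumF λ q → δ (col γ ω) q * isn (col β ω) (tr q) r′)
      ≡⟨ sum-swap (λ ω q → δ (col γ ω) q * isn (col β ω) (tr q) r′) ⟩
    sumF (λ q → sumF λ ω → δ (col γ ω) q * isn (col β ω) (tr q) r′)
      ≡⟨ sum-cong (λ q → sum-fibres (λ ω → δ (col γ ω) q) (col β) λ p → isn p (tr q) r′) ⟩
    sumF (λ q → sumF λ p → sumF (λ ω → δ (col γ ω) q * δ (col β ω) p) * isn p (tr q) r′)
      ≡⟨ sum-cong (λ q → sum-cong λ p → cong (_* isn p (tr q) r′)
           (trans (sym (isn-tr-sum q p γ β)) (cong (isn q (tr p)) (tr-spec β γ)))) ⟩
    sumF (λ q → sumF λ p → isn q (tr p) (tr (col β γ)) * isn p (tr q) r′) ∎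
    where
    open ≡-Reasoning
    r′ = col β γ′

  -- Summed over all γ₁ ∈ βr and γ₁′ ∈ βr′, the count depends on ω and ω′ only through their
  -- common colour from β, so ω′ may be replaced by ω; what remains is the indistinguishing number.
  confusion≤ : ∀ β γ γ′ → col β γ ≢ col β γ′ → confusion β γ γ′ ≤ maxVal X * indist X
  -- `U` and `V` are the sizes of `β r` and `β r′`, positive because these sets contain `γ` and
  -- `γ′`; the averaged inequality carries both as factors.
  confusion≤ β γ γ′ r≢r′ = *-cancelˡ-≤ U {{>-nonZero U>0}} (*-cancelˡ-≤ V {{>-nonZero V>0}} scaled)
    where
    open ≤-Reasoning
    r r′ : Fin m
    r  = col β γ
    r′ = col β γ′
    k c U V : ℕ
    k = maxVal X
    c = indist X
    u v : Fin n → ℕ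
    u γ₁ = δ (col β γ₁) r
    v γ₁ = δ (col β γ₁) r′
    U = sumF u
    V = sumF v
    U>0 : 0 < U
    U>0 = ≤-trans (≤-reflexive (sym (ι-true {r == r} (≡⇒== refl)))) (term≤sum u γ)
    V>0 : 0 < V
    V>0 = ≤-trans (≤-reflexive (sym (ι-true {r′ == r′} (≡⇒== refl)))) (term≤sum v γ′)

    pairSum : (Fin n → Fin n → ℕ) → ℕ
    pairSum f = sumF λ γ₁ → sumF λ γ₂ → u γ₁ * (v γ₂ * f γ₁ γ₂)

    pairSum-const : ∀ x → pairSum (λ _ _ → x) ≡ V * (U * x)
    pairSum-const x = begin-equality
      sumF (λ γ₁ → sumF λ γ₂ → u γ₁ * (v γ₂ * x))
        ≡⟨ sum-cong (λ γ₁ → trans (sum-*ˡ (u γ₁) λ γ₂ → v γ₂ * x) (cong (u γ₁ *_) (sum-*ʳ v x))) ⟩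
      sumF (λ γ₁ → u γ₁ * (V * x))
        ≡⟨ sum-*ʳ u (V * x) ⟩
      U * (V * x)
        ≡⟨ exchange U V x ⟩
      V * (U * x) ∎
      where
      exchange : ∀ a b d → a * (b * d) ≡ b * (a * d)
      exchange = solve-∀

    h : Fin n → Fin n → ℕ
    h ω ω′ = pairSum λ γ₁ γ₂ → δ (col γ₂ ω′) (col γ₁ ω)

    -- Once the common colour `q` is fixed, `γ₁` and `γ₂` are counted independently, and `ω`, `ω′`
    -- enter only through their colours from `β`.
    h-isn : ∀ ω ω′ → h ω ω′ ≡ sumF λ q → isn r q (col β ω) * isn r′ q (col β ω′)
    h-isn ω ω′ = begin-equality
      sumF (λ γ₁ → sumF λ γ₂ → u γ₁ * (v γ₂ * δ (col γ₂ ω′) (col γ₁ ω)))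
        ≡⟨ sum-cong (λ γ₁ → trans (sum-*ˡ (u γ₁) λ γ₂ → v γ₂ * δ (col γ₂ ω′) (col γ₁ ω))
             (cong (u γ₁ *_) (sym (isn-sum r′ (col γ₁ ω) β ω′)))) ⟩
      sumF (λ γ₁ → u γ₁ * isn r′ (col γ₁ ω) (col β ω′))
        ≡⟨ sum-fibres u (λ γ₁ → col γ₁ ω) (λ q → isn r′ q (col β ω′)) ⟩
      sumF (λ q → sumF (λ γ₁ → u γ₁ * δ (col γ₁ ω) q) * isn r′ q (col β ω′))
        ≡⟨ sum-cong (λ q → cong (_* isn r′ q (col β ω′)) (sym (isn-sum r q β ω))) ⟩
      sumF (λ q → isn r q (col β ω) * isn r′ q (col β ω′)) ∎

    h-straighten : ∀ ω ω′ → δ (col β ω′) (col β ω) * h ω ω′ ≡ δ (col β ω′) (col β ω) * h ω ω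
    h-straighten ω ω′ = ι*-cong (col β ω′ == col β ω) λ e → trans (h-isn ω ω′)
      (trans (sum-cong λ q → cong (λ p → isn r q (col β ω) * isn r′ q p) (==⇒≡ e)) (sym (h-isn ω ω)))

    scaled : V * (U * confusion β γ γ′) ≤ V * (U * (k * c))
    scaled = begin
      V * (U * confusion β γ γ′)
        ≡⟨ sym (pairSum-const (confusion β γ γ′)) ⟩
      pairSum (λ _ _ → confusion β γ γ′)
        ≡⟨ sum-cong (λ γ₁ → sum-cong λ γ₂ → same γ₁ γ₂) ⟩
      pairSum (confusion β)
        ≡⟨ sum-cong (λ γ₁ → sum-cong λ γ₂ → distribute γ₁ γ₂) ⟩
      sumF (λ γ₁ → sumF λ γ₂ → sumF λ ω → sumF λ ω′ → e ω ω′ * w γ₁ γ₂ ω ω′)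
        ≡⟨ sum₂-swap (λ γ₁ γ₂ ω ω′ → e ω ω′ * w γ₁ γ₂ ω ω′) ⟩
      sumF (λ ω → sumF λ ω′ → sumF λ γ₁ → sumF λ γ₂ → e ω ω′ * w γ₁ γ₂ ω ω′)
        ≡⟨ sum-cong (λ ω → sum-cong λ ω′ → trans
             (sum-cong λ γ₁ → sum-*ˡ (e ω ω′) λ γ₂ → w γ₁ γ₂ ω ω′)
             (sum-*ˡ (e ω ω′) λ γ₁ → sumF λ γ₂ → w γ₁ γ₂ ω ω′)) ⟩
      sumF (λ ω → sumF λ ω′ → e ω ω′ * h ω ω′)
        ≡⟨ sum-cong (λ ω → trans (sum-cong λ ω′ → h-straighten ω ω′) (sum-*ʳ (e ω) (h ω ω))) ⟩
      sumF (λ ω → sumF (e ω) * h ω ω)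
        -- `sumF (e ω)` is the valency of `col β ω`: the number of choices of `ω′` for a given `ω`.
        ≤⟨ sum-mono-≤ (λ ω → *-monoˡ-≤ (h ω ω)
             (≤-trans (≤-reflexive (sym (val-sum β (col β ω)))) (val≤maxVal β (col β ω)))) ⟩
      sumF (λ ω → k * h ω ω)
        ≡⟨ sum-*ˡ k (λ ω → h ω ω) ⟩
      k * sumF (λ ω → h ω ω)
        ≡⟨ cong (k *_) gather ⟩
      k * pairSum (λ γ₁ γ₂ → cOf X (col γ₁ γ₂))
        ≤⟨ *-monoʳ-≤ k (sum-mono-≤ λ γ₁ → sum-mono-≤ λ γ₂ → bound γ₁ γ₂) ⟩
      k * pairSum (λ _ _ → c)
        ≡⟨ cong (k *_) (pairSum-const c) ⟩
      k * (V * (U * c))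
        ≡⟨ exchange k V U c ⟩
      V * (U * (k * c)) ∎
      where
      exchange : ∀ a b d f → a * (b * (d * f)) ≡ b * (d * (a * f))
      exchange = solve-∀
      e : Fin n → Fin n → ℕ
      e ω ω′ = δ (col β ω′) (col β ω)
      w : (γ₁ γ₂ ω ω′ : Fin n) → ℕ
      w γ₁ γ₂ ω ω′ = u γ₁ * (v γ₂ * δ (col γ₂ ω′) (col γ₁ ω))
      same : ∀ γ₁ γ₂ → u γ₁ * (v γ₂ * confusion β γ γ′) ≡ u γ₁ * (v γ₂ * confusion β γ₁ γ₂)
      same γ₁ γ₂ = ι*-cong (col β γ₁ == r) λ e₁ → ι*-cong (col β γ₂ == r′) λ e₂ →
        trans (confusion-isn β γ γ′) (trans
          (cong₂ (λ s s′ → sumF λ q → sumF λ p → isn q (tr p) (tr s) * isn p (tr q) s′)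
            (sym (==⇒≡ e₁)) (sym (==⇒≡ e₂)))
          (sym (confusion-isn β γ₁ γ₂)))
      rearrange : ∀ a b d f → a * (b * (d * f)) ≡ d * (a * (b * f))
      rearrange = solve-∀
      distribute : ∀ γ₁ γ₂ → u γ₁ * (v γ₂ * confusion β γ₁ γ₂) ≡ sumF λ ω → sumF λ ω′ → e ω ω′ * w γ₁ γ₂ ω ω′
      distribute γ₁ γ₂ = begin-equality
        u γ₁ * (v γ₂ * confusion β γ₁ γ₂)
          ≡⟨ sym (*-assoc (u γ₁) (v γ₂) _) ⟩
        u γ₁ * v γ₂ * confusion β γ₁ γ₂
          ≡⟨ sym (sum-*ˡ (u γ₁ * v γ₂) λ ω → sumF λ ω′ → e ω ω′ * δ (col γ₂ ω′) (col γ₁ ω)) ⟩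
        sumF (λ ω → u γ₁ * v γ₂ * sumF λ ω′ → e ω ω′ * δ (col γ₂ ω′) (col γ₁ ω))
          ≡⟨ sum-cong (λ ω → trans (sym (sum-*ˡ (u γ₁ * v γ₂) λ ω′ → e ω ω′ * δ (col γ₂ ω′) (col γ₁ ω))) (sum-cong λ ω′ →
               trans (*-assoc (u γ₁) (v γ₂) _) (rearrange (u γ₁) (v γ₂) (e ω ω′) _))) ⟩
        sumF (λ ω → sumF λ ω′ → e ω ω′ * w γ₁ γ₂ ω ω′) ∎
      gather : sumF (λ ω → h ω ω) ≡ pairSum (λ γ₁ γ₂ → cOf X (col γ₁ γ₂))
      gather = begin-equality
        sumF (λ ω → sumF λ γ₁ → sumF λ γ₂ → w γ₁ γ₂ ω ω)
          ≡⟨ sum-swap (λ ω γ₁ → sumF λ γ₂ → w γ₁ γ₂ ω ω) ⟩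
        sumF (λ γ₁ → sumF λ ω → sumF λ γ₂ → w γ₁ γ₂ ω ω)
          ≡⟨ sum-cong (λ γ₁ → sum-swap λ ω γ₂ → w γ₁ γ₂ ω ω) ⟩
        sumF (λ γ₁ → sumF λ γ₂ → sumF λ ω → w γ₁ γ₂ ω ω)
          ≡⟨ sum-cong (λ γ₁ → sum-cong λ γ₂ → trans
               (sum-*ˡ (u γ₁) λ ω → v γ₂ * δ (col γ₂ ω) (col γ₁ ω)) (cong (u γ₁ *_)
               (trans (sum-*ˡ (v γ₂) λ ω → δ (col γ₂ ω) (col γ₁ ω)) (cong (v γ₂ *_) (sym (cOf-sum γ₁ γ₂)))))) ⟩
        pairSum (λ γ₁ γ₂ → cOf X (col γ₁ γ₂)) ∎
      bound : ∀ γ₁ γ₂ → u γ₁ * (v γ₂ * cOf X (col γ₁ γ₂)) ≤ u γ₁ * (v γ₂ * c)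
      bound γ₁ γ₂ = ι*-mono (col β γ₁ == r) λ e₁ → ι*-mono (col β γ₂ == r′) λ e₂ →
        -- Since `r` and `r′` differ, `γ₁` and `γ₂` are distinct, as the bound by `indist` requires.
        cOf≤indist γ₁ γ₂ λ { refl → r≢r′ (trans (sym (==⇒≡ e₁)) (==⇒≡ e₂)) }

  -- Ambiguous edges and the choice of an apex.

  rival : (α β γ γ′ : Fin n) → Bool
  rival α β γ γ′ = (col α γ′ == col α γ) ∧ not (col β γ′ == col β γ)

  -- All rivals lie in `α s` for `s = col α γ`, and `γ` lies there without being a rival; hence the
  -- `∸ 1`.
  #rival≤ : ∀ α β γ → # rival α β γ ≤ maxVal X ∸ 1
  #rival≤ α β γ = ∸-monoˡ-≤ 1 (begin-strict
    # rival α β γ                    ≡⟨ #-sum (rival α β γ) ⟩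
    sumF (ι ∘ rival α β γ)           <⟨ sum-mono-< below γ strictAt ⟩
    sumF (λ γ′ → δ (col α γ′) (col α γ)) ≡⟨ sym (val-sum α (col α γ)) ⟩
    val X α (col α γ)                ≤⟨ val≤maxVal α (col α γ) ⟩
    maxVal X                         ∎)
    where
    open ≤-Reasoning
    below : ∀ γ′ → ι (rival α β γ γ′) ≤ δ (col α γ′) (col α γ)
    below γ′ = ≤-trans (≤-reflexive (ι-∧ (col α γ′ == col α γ) _))
      (≤-trans (*-monoʳ-≤ (δ (col α γ′) (col α γ)) (ι≤1 _)) (≤-reflexive (*-identityʳ _)))
    strictAt : ι (rival α β γ γ) < δ (col α γ) (col α γ)
    strictAt with col α γ ≟F col α γ | col β γ ≟F col β γ
    ... | no ≢  | _     = ⊥-elim (≢ refl)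
    ... | _     | no ≢  = ⊥-elim (≢ refl)
    ... | yes _ | yes _ = s≤s z≤n

  -- If the ambiguity vanishes, the colour of (β , γ) is determined by the colours of the
  -- other five edges of the tetrahedron α β γ ω.
  ambiguity : (α β γ ω : Fin n) → ℕ
  ambiguity α β γ ω = sumF λ γ′ → ι (rival α β γ γ′) *
    sumF λ ω′ → δ (col β ω′) (col β ω) * δ (col γ′ ω′) (col γ ω)

  -- After the sums are interchanged, each rival contributes a confusion number, and `confusion≤`
  -- applies because a rival has a different colour from `β`.
  ambiguity-sum≤ : ∀ α β γ → sumF (ambiguity α β γ) ≤ (maxVal X ∸ 1) * (maxVal X * indist X)
  ambiguity-sum≤ α β γ = begin
    sumF (ambiguity α β γ)
      ≡⟨ trans (sum-swap λ ω γ′ → ι (rival α β γ γ′) * confused γ′ ω)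
           (sum-cong λ γ′ → sum-*ˡ (ι (rival α β γ γ′)) (confused γ′)) ⟩
    sumF (λ γ′ → ι (rival α β γ γ′) * confusion β γ γ′)
      ≤⟨ sum-mono-≤ (λ γ′ → ι*-mono (rival α β γ γ′) λ h → confusion≤ β γ γ′ λ eq →
           T-not⁻ (proj₂ (∧⁻ {col α γ′ == col α γ} h)) (≡⇒== (sym eq))) ⟩
    sumF (λ γ′ → ι (rival α β γ γ′) * (maxVal X * indist X))
      ≡⟨ trans (sum-*ʳ (ι ∘ rival α β γ) _) (cong (_* (maxVal X * indist X)) (sym (#-sum (rival α β γ)))) ⟩
    # rival α β γ * (maxVal X * indist X)
      ≤⟨ *-monoˡ-≤ (maxVal X * indist X) (#rival≤ α β γ) ⟩
    (maxVal X ∸ 1) * (maxVal X * indist X) ∎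
    where
    open ≤-Reasoning
    confused : Fin n → Fin n → ℕ
    confused γ′ ω = sumF λ ω′ → δ (col β ω′) (col β ω) * δ (col γ′ ω′) (col γ ω)

  -- If the colours differed, `γ′` would be a rival and `ω′` would contribute a term 1 to the
  -- ambiguity.
  ambiguity≡0⇒ : ∀ {α β γ ω γ′ ω′} → ambiguity α β γ ω ≡ 0 → col α γ′ ≡ col α γ →
                 col β ω′ ≡ col β ω → col γ′ ω′ ≡ col γ ω → col β γ′ ≡ col β γ
  ambiguity≡0⇒ {α} {β} {γ} {ω} {γ′} {ω′} A≡0 αγ βω γω with col β γ′ ≟F col β γ
  ... | yes βγ = βγ
  ... | no  ≢  = ⊥-elim (<-irrefl (sym A≡0) (begin-strict
    0 <⟨ s≤s z≤n ⟩
    1 * (1 * 1)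
      ≡⟨ sym (cong₂ _*_ (ι-true (∧⁺ {col α γ′ == col α γ} (≡⇒== αγ) (T-not⁺ (≢ ∘ ==⇒≡))))
           (cong₂ _*_ (ι-true {col β ω′ == col β ω} (≡⇒== βω)) (ι-true {col γ′ ω′ == col γ ω} (≡⇒== γω)))) ⟩
    ι (rival α β γ γ′) * (δ (col β ω′) (col β ω) * δ (col γ′ ω′) (col γ ω))
      ≤⟨ *-monoʳ-≤ (ι (rival α β γ γ′)) (term≤sum (λ ω′ → δ (col β ω′) (col β ω) * δ (col γ′ ω′) (col γ ω)) ω′) ⟩
    ι (rival α β γ γ′) * sumF (λ ω′ → δ (col β ω′) (col β ω) * δ (col γ′ ω′) (col γ ω))
      ≤⟨ term≤sum (λ γ′ → ι (rival α β γ γ′) * sumF λ ω′ → δ (col β ω′) (col β ω) * δ (col γ′ ω′) (col γ ω)) γ′ ⟩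
    ambiguity α β γ ω ∎))
    where open ≤-Reasoning

  -- The sets `α r` for `r` of maximum valency are disjoint and have `maxVal X` points each.
  maxVal*sizeSk≤n : Fin n → maxVal X * sizeSk X ≤ n
  maxVal*sizeSk≤n α = begin
    maxVal X * sizeSk X
      ≡⟨ trans (cong (maxVal X *_) (#-sum (inSk X))) (sym (sum-*ˡ (maxVal X) (ι ∘ inSk X))) ⟩
    sumF (λ r → maxVal X * ι (inSk X r))
      ≤⟨ sum-mono-≤ bound ⟩
    sumF (val X α)
      ≡⟨ trans (sum-cong (val-sum α)) (sum-swap λ r β → δ (col α β) r) ⟩
    sumF (λ β → sumF λ r → δ (col α β) r)
      ≡⟨ sum-cong (λ β → trans (sum-cong λ r → sym (*-identityʳ (δ (col α β) r))) (δ-sift (col α β) λ _ → 1)) ⟩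
    sumF {n} (λ _ → 1)
      ≡⟨ sum-one n ⟩
    n ∎
    where
    open ≤-Reasoning
    bound : ∀ r → maxVal X * ι (inSk X r) ≤ val X α r
    bound r with inSk X r in eq
    ... | false = ≤-trans (≤-reflexive (*-zeroʳ (maxVal X))) z≤n
    ... | true  = ≤-reflexive (trans (*-identityʳ _) (sym (val-inSk α r (subst T (sym eq) tt))))

  -- The three ambiguities, summed over all `ω`, total less than `n`; at some `ω` their sum
  -- vanishes, and with it each of them.
  unambiguous-apex : 1 < maxVal X → Condition X → ∀ α β γ δ′ → ∃ λ ω →
    ambiguity α β γ ω ≡ 0 × ambiguity α β δ′ ω ≡ 0 × ambiguity α γ δ′ ω ≡ 0
  unambiguous-apex 1<k cond α β γ δ′ =
    ω , m+n≡0⇒m≡0 _ eq , m+n≡0⇒m≡0 _ eq′ , m+n≡0⇒n≡0 (ambiguity α β δ′ ω) eq′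
    where
    open ≤-Reasoning
    k c B : ℕ
    k = maxVal X
    c = indist X
    B = (k ∸ 1) * (k * c)
    regroup : ∀ a k c → a * (k * c) + (a * (k * c) + a * (k * c)) ≡ k * (3 * c * a)
    regroup = solve-∀
    total : sumF (λ ω → ambiguity α β γ ω + (ambiguity α β δ′ ω + ambiguity α γ δ′ ω)) < n
    total = begin-strict
      sumF (λ ω → ambiguity α β γ ω + (ambiguity α β δ′ ω + ambiguity α γ δ′ ω))
        ≡⟨ trans (sum-+ (ambiguity α β γ) _) (cong (_ +_) (sum-+ (ambiguity α β δ′) _)) ⟩
      sumF (ambiguity α β γ) + (sumF (ambiguity α β δ′) + sumF (ambiguity α γ δ′))
        ≤⟨ +-mono-≤ (ambiguity-sum≤ α β γ) (+-mono-≤ (ambiguity-sum≤ α β δ′) (ambiguity-sum≤ α γ δ′)) ⟩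
      -- One copy of `B` for each of the edges `β γ`, `β δ′` and `γ δ′`.
      B + (B + B)
        ≡⟨ regroup (k ∸ 1) k c ⟩
      k * (3 * c * (k ∸ 1))
        ≤⟨ *-monoʳ-≤ k (*-monoˡ-≤ (k ∸ 1) (*-monoˡ-≤ c {3} {6} (s≤s (s≤s (s≤s z≤n))))) ⟩
      k * (6 * c * (k ∸ 1))
        <⟨ *-monoʳ-< k {{>-nonZero (<-trans (s≤s z≤n) 1<k)}} cond ⟩
      k * sizeSk X
        ≤⟨ maxVal*sizeSk≤n α ⟩
      n ∎
    found = sum<n⇒zero _ total
    ω   = proj₁ found
    eq  = proj₂ found
    eq′ = m+n≡0⇒n≡0 (ambiguity α β γ ω) eq

  prodB⁺ : ∀ {x y r} α β γ → col α β ≡ x → col α γ ≡ y → col β γ ≡ r → T (prodB X x y r)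
  prodB⁺ α β γ p q s = anyF⁺ _ α (anyF⁺ _ β (anyF⁺ _ γ (∧⁺ (≡⇒== p) (∧⁺ (≡⇒== q) (≡⇒== s)))))

  prodB⁻ : ∀ {x y r} → T (prodB X x y r) →
           ∃ λ α → ∃ λ β → ∃ λ γ → col α β ≡ x × col α γ ≡ y × col β γ ≡ r
  prodB⁻ {x} {y} {r} h =
    let α , h₁ = anyF⁻ _ h
        β , h₂ = anyF⁻ _ h₁
        γ , h₃ = anyF⁻ _ h₂
        p , h₄ = ∧⁻ {col α β == x} h₃
        q , s  = ∧⁻ {col α γ == y} h₄
    in α , β , γ , ==⇒≡ p , ==⇒≡ q , ==⇒≡ s

-- Transport of triangles and tetrahedra along an algebraic isomorphism.

module Isomorphism {n m n′ m′} (X : CC n m) (X′ : CC n′ m′)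
                   (homogeneous : Homogeneous X) (Φ : AlgIso X X′) where
  private
    module X = CC X
    module X′ = CC X′

  open AlgIso Φ using (pres)
  open Bijection (AlgIso.φ Φ) using (injective; strictlySurjective) renaming (to to φ)
  open Reindex (AlgIso.φ Φ)
  open Scheme X homogeneous

  Same : Fin n → Fin n → Fin n′ → Fin n′ → Set
  Same α β α′ β′ = X′.col α′ β′ ≡ φ (X.col α β)

  count-path : ∀ {α β α′ β′} → Same α β α′ β′ → ∀ r s →
    # (λ γ → (X.col α γ == r) ∧ (X.col γ β == s)) ≡ # (λ γ′ → (X′.col α′ γ′ == φ r) ∧ (X′.col γ′ β′ == φ s))
  count-path {α} {β} {α′} {β′} αβ r s = trans (X.isn-spec r s _ α β refl)
    (trans (pres r s (X.col α β)) (sym (X′.isn-spec (φ r) (φ s) _ α′ β′ αβ)))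

  -- The vertex `γ` makes an intersection number positive, so the equal number over `α′ β′` is
  -- positive too.
  lift-path : ∀ {α β α′ β′} → Same α β α′ β′ → ∀ γ → ∃ λ γ′ → Same α γ α′ γ′ × Same γ β γ′ β′
  lift-path {α} {β} αβ γ =
    let γ′ , h = #⁻ _ (subst (0 <_) (count-path αβ (X.col α γ) (X.col γ β))
                        (#⁺ _ γ (∧⁺ {X.col α γ == X.col α γ} (≡⇒== refl) (≡⇒== refl))))
        p , q  = ∧⁻ h
    in γ′ , ==⇒≡ p , ==⇒≡ q

  drop-path : ∀ {α β α′ β′} → Same α β α′ β′ → ∀ γ′ → ∃ λ γ → Same α γ α′ γ′ × Same γ β γ′ β′
  drop-path {α} {β} {α′} {β′} αβ γ′ =
    let r , rφ = strictlySurjective (X′.col α′ γ′)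
        s , sφ = strictlySurjective (X′.col γ′ β′)
        γ , h  = #⁻ _ (subst (0 <_) (sym (count-path αβ r s))
                        (#⁺ _ γ′ (∧⁺ (≡⇒== (sym rφ)) (≡⇒== (sym sφ)))))
        p , q  = ∧⁻ h
    in γ , trans (sym rφ) (cong φ (sym (==⇒≡ p))) , trans (sym sφ) (cong φ (sym (==⇒≡ q)))

  -- Pull the loop colour at `α′` back to the colour of some `β γ`, and lift the path `β β γ` over
  -- the loop. Its midpoint `γ′` is joined to `α′` by the loop colour, so `γ′` is `α′`, and the loop
  -- at `β` lies below the loop at `α′`. Homogeneity replaces `β` by `α`.
  same-refl : ∀ α α′ → Same α α α′ α′
  same-refl α α′ =
    let t , tφ       = strictlySurjective (X′.col α′ α′)
        β , γ , βγ≡t = X.nonempty t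
        γ′ , p , q   = lift-path {β} {γ} {α′} {α′} (trans (sym tφ) (cong φ (sym βγ≡t))) β
        γ′≡α′        = X′.diag α′ γ′ α′ (trans q (trans (cong φ βγ≡t) tφ))
    in trans (cong (X′.col α′) (sym γ′≡α′)) (trans p (cong φ (homogeneous β α)))

  -- By `same-refl` every loop of `X′` has the image of the single loop colour of `X`. The point `α`
  -- comes from a representative of a colour.
  homogeneous′ : Homogeneous X′
  homogeneous′ α′ β′ =
    let α , _ = X.nonempty (proj₁ (strictlySurjective (X′.col α′ α′)))
    in trans (same-refl α α′) (sym (same-refl α β′))

  module Scheme′ = Scheme X′ homogeneous′

  -- `AlgIso` speaks only of intersection numbers, so transposition is recovered by lifting the
  -- closed path `α β α`: its midpoint `γ′` has the same colour from `α′` as `β′`, hence the same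
  -- transposed colour.
  same-sym : ∀ {α β α′ β′} → Same α β α′ β′ → Same β α β′ α′
  same-sym {α} {β} {α′} {β′} αβ =
    let γ′ , p , q = lift-path (same-refl α α′) β
    in trans (X′.tr-spec α′ β′) (trans (cong X′.tr (trans αβ (sym p))) (trans (sym (X′.tr-spec α′ γ′)) q))

  lift : ∀ {α β α′ β′} → Same α β α′ β′ → ∀ γ → ∃ λ γ′ → Same α γ α′ γ′ × Same β γ β′ γ′
  lift αβ γ = let γ′ , p , q = lift-path αβ γ in γ′ , p , same-sym q

  drop : ∀ {α β α′ β′} → Same α β α′ β′ → ∀ γ′ → ∃ λ γ → Same α γ α′ γ′ × Same β γ β′ γ′
  drop αβ γ′ = let γ , p , q = drop-path αβ γ′ in γ , p , same-sym q

  -- Drop `γ′` over `α β`, then `ω′` over `β γ₁`. In `X` the points `γ₁` and `ω₁` now satisfy the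
  -- hypotheses of `ambiguity≡0⇒`, which gives `β γ₁` the colour of `β γ`.
  determine : ∀ {α β γ ω α′ β′ γ′ ω′} → ambiguity α β γ ω ≡ 0 →
    Same α β α′ β′ → Same α γ α′ γ′ → Same β ω β′ ω′ → Same γ ω γ′ ω′ → Same β γ β′ γ′
  determine {γ′ = γ′} {ω′} A≡0 αβ αγ βω γω =
    let γ₁ , αγ₁ , βγ₁ = drop αβ γ′
        ω₁ , βω₁ , γω₁ = drop βγ₁ ω′
    in trans βγ₁ (cong φ (ambiguity≡0⇒ A≡0 (injective (trans (sym αγ₁) αγ))
         (injective (trans (sym βω₁) βω)) (injective (trans (sym γω₁) γω))))

  -- The Desargues-type step: an apex ω off the tetrahedron is transported first; the three
  -- edges of the face β γ δ are then forced by their cones from α and from ω.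
  transport : 1 < maxVal X → Condition X → ∀ {α β α′ β′} → Same α β α′ β′ → ∀ γ δ → ∃ λ γ′ → ∃ λ δ′ →
    Same α γ α′ γ′ × Same α δ α′ δ′ × Same β γ β′ γ′ × Same β δ β′ δ′ × Same γ δ γ′ δ′
  transport 1<k cond {α} {β} αβ γ δ =
    let ω , A₁ , A₂ , A₃ = unambiguous-apex 1<k cond α β γ δ
        ω′ , αω , βω = lift αβ ω
        γ′ , αγ , ωγ = lift αω γ
        δ′ , αδ , ωδ = lift αω δ
    in γ′ , δ′ , αγ , αδ ,
       determine A₁ αβ αγ βω (same-sym ωγ) ,
       determine A₂ αβ αδ βω (same-sym ωδ) ,
       determine A₃ αγ αδ (same-sym ωγ) (same-sym ωδ)

  -- Invariance of the numerical parameters and of the labelled relations.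

  tr-pres : ∀ r → φ (X.tr r) ≡ X′.tr (φ r)
  tr-pres r =
    let α , β , αβ≡r     = X.nonempty r
        α′ , β′ , αβ′≡φr = X′.nonempty (φ r)
        βα = same-sym (trans αβ′≡φr (cong φ (sym αβ≡r)))
    in trans (cong φ (trans (cong X.tr (sym αβ≡r)) (sym (X.tr-spec α β))))
       (trans (sym βα) (trans (X′.tr-spec α′ β′) (cong X′.tr αβ′≡φr)))

  val-pres : ∀ α α′ r → val X′ α′ (φ r) ≡ val X α r
  val-pres α α′ r = sym (trans (val-isn α r) (trans (pres r (X.tr r) (X.col α α))
    (trans (cong₂ (X′.isn (φ r)) (tr-pres r) (sym (same-refl α α′))) (sym (Scheme′.val-isn α′ (φ r))))))

  valOf-pres : ∀ r → valOf X′ (φ r) ≡ valOf X r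
  valOf-pres r =
    let α , _  = X.nonempty r
        α′ , _ = X′.nonempty (φ r)
    in trans (Scheme′.valOf≡val α′ (φ r)) (trans (val-pres α α′ r) (sym (valOf≡val α r)))

  maxVal-pres : maxVal X ≡ maxVal X′
  maxVal-pres = max-reindex valOf-pres

  inSk-pres : ∀ r → inSk X′ (φ r) ≡ inSk X r
  inSk-pres r = cong₂ _≡ᵇ_ (valOf-pres r) (sym maxVal-pres)

  reflB-pres : ∀ r → reflB X′ (φ r) ≡ reflB X r
  reflB-pres r with X.nonempty r | X′.nonempty (φ r)
  ... | α , β , αβ≡r | α′ , β′ , αβ′≡φr = T-antisym down up
    where
    down : T (reflB X′ (φ r)) → T (reflB X r)
    down h with refl ← Scheme′.reflB⁻ α′ β′ (subst (T ∘ reflB X′) (sym αβ′≡φr) h) =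
      reflB⁺ α r (injective (trans (sym αβ′≡φr) (same-refl α α′)))
    up : T (reflB X r) → T (reflB X′ (φ r))
    up h with refl ← reflB⁻ α β (subst (T ∘ reflB X) (sym αβ≡r) h) =
      Scheme′.reflB⁺ α′ (φ r) (trans (cong φ (sym αβ≡r)) (sym (same-refl α α′)))

  cOf-pres : ∀ r → cOf X′ (φ r) ≡ cOf X r
  cOf-pres r = sym (sum-reindex λ s → trans (cong (λ s* → X′.isn (φ s) s* (φ r)) (sym (tr-pres s)))
                                            (sym (pres s (X.tr s) r)))

  indist-pres : indist X ≡ indist X′
  indist-pres = max-reindex λ r → cong₂ (λ b c → if b then 0 else c) (reflB-pres r) (cOf-pres r)

  condition-pres : Condition X → Condition X′
  condition-pres = subst₂ _<_ (cong₂ (λ c k → 6 * c * (k ∸ 1)) indist-pres maxVal-pres) (#-reindex inSk-pres)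

  prodB-pres : ∀ x y r → prodB X′ (φ x) (φ y) (φ r) ≡ prodB X x y r
  prodB-pres x y r = T-antisym down up
    where
    down : T (prodB X′ (φ x) (φ y) (φ r)) → T (prodB X x y r)
    down h =
      let α′ , β′ , γ′ , p , q , s = Scheme′.prodB⁻ h
          α , β , αβ≡x = X.nonempty x
          γ , αγ , βγ  = drop (trans p (cong φ (sym αβ≡x))) γ′
      in prodB⁺ α β γ αβ≡x (injective (trans (sym αγ) q)) (injective (trans (sym βγ) s))
    up : T (prodB X x y r) → T (prodB X′ (φ x) (φ y) (φ r))
    up h =
      let α , β , γ , p , q , s = prodB⁻ h
          α′ , β′ , αβ′≡φx = X′.nonempty (φ x)
          γ′ , αγ , βγ     = lift (trans αβ′≡φx (cong φ (sym p))) γ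
      in Scheme′.prodB⁺ α′ β′ γ′ αβ′≡φx (trans αγ (cong φ q)) (trans βγ (cong φ s))

  sim-pres : ∀ x y → sim X′ (φ x) (φ y) ≡ sim X x y
  sim-pres x y = cong₂ _≡ᵇ_ (sym (#-reindex (prodB-pres x y))) (sym maxVal-pres)

  mapLabel : Label X → Label X′
  mapLabel (inj₁ ((x , y , r) , t)) = inj₁ ((φ x , φ y , φ r) , subst T (sym eq) t)
    where
    eq = cong₂ _∧_ (inSk-pres x) (cong₂ _∧_ (inSk-pres y) (cong₂ _∧_ (sim-pres x y) (prodB-pres x y r)))
  mapLabel (inj₂ (x , t)) = inj₂ (φ x , subst T (sym eq) t)
    where
    eq = cong₂ _∧_ (inSk-pres x) (cong not (sim-pres x x))

  underlying-mapLabel : ∀ l → underlying X′ (mapLabel l) ≡ liftφ φ (underlying X l)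
  underlying-mapLabel (inj₁ _) = refl
  underlying-mapLabel (inj₂ _) = refl

  liftφ-injective : ∀ {u v} → liftφ φ u ≡ liftφ φ v → u ≡ v
  liftφ-injective {inj₁ (x , y , r)} {inj₁ (x₁ , y₁ , r₁)} eq with inj₁-injective eq
  ... | e = cong inj₁ (cong₂ _,_ (injective (cong proj₁ e))
              (cong₂ _,_ (injective (cong (proj₁ ∘ proj₂) e)) (injective (cong (proj₂ ∘ proj₂) e))))
  liftφ-injective {inj₂ x} {inj₂ y} eq = cong inj₂ (injective (inj₂-injective eq))

  mrel-pres : ∀ {α β γ α′ β′ γ′} l → Same α β α′ β′ → Same α γ α′ γ′ → Same β γ β′ γ′ →
              mrel X α l β γ ≡ mrel X′ α′ (mapLabel l) β′ γ′
  mrel-pres {α} {β} {γ} {α′} {β′} {γ′} (inj₁ ((x , y , r) , _)) αβ αγ βγ =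
    cong₂ _∧_ (==-pres αβ) (cong₂ _∧_ (==-pres αγ) (==-pres βγ))
    where
    ==-pres : ∀ {s t′ t} → t′ ≡ φ s → (s == t) ≡ (t′ == φ t)
    ==-pres eq = ==-cong (λ e → trans eq (cong φ e)) (λ e → injective (trans (sym eq) e))
  mrel-pres {α} {β} {γ} {α′} {β′} {γ′} (inj₂ (x , _)) αβ αγ βγ =
    cong₂ _∧_ (==-cong (λ e → trans αβ (cong φ e)) (λ e → injective (trans (sym αβ) e)))
      -- Equality of points is itself a condition on colours, by `diag` and `same-refl`.
      (==-cong (λ { refl → X′.diag β′ β′ γ′ (trans βγ (sym (same-refl β β′))) })
               (λ { refl → X.diag β β γ (injective (trans (sym βγ) (same-refl β β′))) }))

  -- A label fixes all three colours of the triangle at `α`; for a diagonal label the triangle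
  -- degenerates to one edge and a loop.
  mrel-same : ∀ {α β γ α′ β′ γ′} l → T (mrel X α l β γ) → T (mrel X′ α′ (mapLabel l) β′ γ′) →
              Same α β α′ β′ × Same α γ α′ γ′ × Same β γ β′ γ′
  mrel-same {α} {β} {γ} {α′} {β′} {γ′} (inj₁ ((x , y , r) , _)) h h′ =
    let p , h₁ = ∧⁻ {X.col α β == x} h
        q , s  = ∧⁻ {X.col α γ == y} h₁
        p′ , h₁′ = ∧⁻ {X′.col α′ β′ == φ x} h′
        q′ , s′  = ∧⁻ {X′.col α′ γ′ == φ y} h₁′
    in same p p′ , same q q′ , same s s′
    where
    same : ∀ {s t s′} → T (s == t) → T (s′ == φ t) → s′ ≡ φ s
    same e e′ = trans (==⇒≡ e′) (cong φ (sym (==⇒≡ e)))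
  mrel-same {α} {β} {γ} {α′} {β′} {γ′} (inj₂ (x , _)) h h′
    with p , e ← ∧⁻ {X.col α β == x} h | p′ , e′ ← ∧⁻ {X′.col α′ β′ == φ x} h′
    with refl ← ==⇒≡ {i = β} {γ} e | refl ← ==⇒≡ {i = β′} {γ′} e′ = αβ , αβ , same-refl β β′
    where
    αβ = trans (==⇒≡ p′) (cong φ (sym (==⇒≡ p)))

-- The relations of the configuration as partial matchings.

label-≡ : (X : CC n m) {l₁ l₂ : Label X} → underlying X l₁ ≡ underlying X l₂ → l₁ ≡ l₂
label-≡ X {inj₁ (t , p)} {inj₁ (.t , q)} refl = cong (λ p → inj₁ (t , p)) (T-irrelevant p q)
label-≡ X {inj₂ (x , p)} {inj₂ (.x , q)} refl = cong (λ p → inj₂ (x , p)) (T-irrelevant p q)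

-- Makes `lift` available inside one configuration, where it moves a triangle to another base of the
-- same colour.
idIso : (X : CC n m) → AlgIso X X
idIso X = record { φ = ⤖-id _ ; pres = λ _ _ _ → refl }

-- αy has maxVal points and x*y has maxVal colours, so each colour is used exactly once.
mrel-functional : (X : CC n m) → Homogeneous X → ∀ {α β γ δ} l →
                  T (mrel X α l β γ) → T (mrel X α l β δ) → γ ≡ δ
mrel-functional {n} {m} X homogeneous {α} {β} {γ} {ε} (inj₁ ((x , y , r) , t)) h h₁
  with γ ≟F ε
... | yes γ≡ε = γ≡ε
... | no  γ≢ε = ⊥-elim (<-irrefl refl (begin-strict
    maxVal X
      ≡⟨ sym (≡ᵇ⇒≡ _ _ (proj₁ (∧⁻ {sim X x y} (proj₂ (∧⁻ {inSk X y} (proj₂ (∧⁻ {inSk X x} t))))))) ⟩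
    # prodB X x y
      ≡⟨ #-sum (prodB X x y) ⟩
    sumF (λ s → ι (prodB X x y s))
      -- Every colour of the product is seen from `β` at some point of `α y`; the colour `r` would
      -- be seen at both `γ` and `ε`.
      <⟨ sum-mono-< used r (≤-<-trans (ι≤1 _) (1<# (to-y r) γ ε γ≢ε
             (proj₂ (∧⁻ {col α β == x} h)) (proj₂ (∧⁻ {col α β == x} h₁)))) ⟩
    sumF (λ s → # to-y s)
      ≡⟨ trans (sum-cong λ s → trans (#-sum (to-y s)) (sum-cong λ ζ → ι-∧ (col α ζ == y) (col β ζ == s)))
               (sum-swap λ s ζ → δ (col α ζ) y * δ (col β ζ) s) ⟩
    sumF (λ ζ → sumF λ s → δ (col α ζ) y * δ (col β ζ) s)
      ≡⟨ sum-cong (λ ζ → trans (sum-cong λ s → *-comm (δ (col α ζ) y) (δ (col β ζ) s))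
                               (δ-sift (col β ζ) λ _ → δ (col α ζ) y)) ⟩
    sumF (λ ζ → δ (col α ζ) y)
      ≡⟨ sym (val-sum α y) ⟩
    val X α y
      ≡⟨ val-inSk α y (proj₁ (∧⁻ {inSk X y} (proj₂ (∧⁻ {inSk X x} t)))) ⟩
    maxVal X ∎))
  where
  open ≤-Reasoning
  open CC X
  open Scheme X homogeneous
  open Isomorphism X X homogeneous (idIso X) using (lift)
  to-y : Fin m → Fin n → Bool
  to-y s ζ = (col α ζ == y) ∧ (col β ζ == s)
  αβ≡x : col α β ≡ x
  αβ≡x = ==⇒≡ (proj₁ (∧⁻ h))
  used : ∀ s → ι (prodB X x y s) ≤ # to-y s
  used s with prodB X x y s in eq
  ... | false = z≤n
  ... | true  =
    let α₁ , β₁ , γ₁ , p , q , s≡ = prodB⁻ (subst T (sym eq) tt)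
        -- The triangle witnessing `s` may sit elsewhere; it is moved onto the base `α β`, which
        -- also has colour `x`.
        ζ , αζ , βζ = lift {α₁} {β₁} {α} {β} (trans αβ≡x (sym p)) γ₁
    in #⁺ (to-y s) ζ (∧⁺ (≡⇒== (trans αζ q)) (≡⇒== (trans βζ s≡)))
mrel-functional X homogeneous {α} {β} {γ} {ε} (inj₂ (x , _)) h h₁ =
  trans (sym (==⇒≡ (proj₂ (∧⁻ {CC.col X α β == x} h)))) (==⇒≡ (proj₂ (∧⁻ {CC.col X α β == x} h₁)))

mcount≤1 : (X : CC n m) → Homogeneous X → ∀ {α β γ} a b → mcount X α a b β γ ≤ 1
mcount≤1 X homogeneous {α} {β} {γ} a b = #≤1 (λ ζ → mrel X α a β ζ ∧ mrel X α b ζ γ) λ ζ ζ₁ h h₁ →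
  mrel-functional X homogeneous a (proj₁ (∧⁻ {mrel X α a β ζ} h)) (proj₁ (∧⁻ {mrel X α a β ζ₁} h₁))

mcount⁺ : (X : CC n m) → ∀ {α β γ} a b ζ → T (mrel X α a β ζ) → T (mrel X α b ζ γ) → 0 < mcount X α a b β γ
mcount⁺ X {α} {β} {γ} a b ζ p q =
  #⁺ (λ ζ → mrel X α a β ζ ∧ mrel X α b ζ γ) ζ (∧⁺ {mrel X α a β ζ} {mrel X α b ζ γ} p q)

mcount⁻ : (X : CC n m) → ∀ {α β γ} a b → 0 < mcount X α a b β γ →
          ∃ λ ζ → T (mrel X α a β ζ) × T (mrel X α b ζ γ)
mcount⁻ X {α} {β} {γ} a b h =
  let ζ , p = #⁻ (λ ζ → mrel X α a β ζ ∧ mrel X α b ζ γ) h in ζ , ∧⁻ {mrel X α a β ζ} {mrel X α b ζ γ} p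

-- The isomorphism between the matching configurations.

theorem5p6 : ∀ {n m n' m'} (X : CC n m) (X' : CC n' m') →
    Homogeneous X → 1 < maxVal X → Condition X → (Φ : AlgIso X X') →
    Condition X' ×
    (∀ (α : Fin n) (α' : Fin n') →
    Σ (Label X ⤖ Label X') λ f →
    (∀ l → underlying X' (Bijection.to f l) ≡ liftφ (AlgIso._′ Φ) (underlying X l)) ×
    IsMIso X X' α α' f ×
    (∀ l r → (∀ β γ → T (mrel X α l β γ) → CC.col X β γ ≡ r) →
    ∀ β' γ' → T (mrel X' α' (Bijection.to f l) β' γ') →
    CC.col X' β' γ' ≡ AlgIso._′ Φ r))
theorem5p6 X X' homogeneous 1<k cond Φ = condition-pres cond , λ α α' →
  mk⤖ (mapLabel-injective , mapLabel-surjective) , underlying-mapLabel , mcount-pres , colour-pres α α'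
  where
  open Isomorphism X X' homogeneous Φ
  open Bijection (AlgIso.φ Φ) using (strictlySurjective)

  mapLabel-injective : ∀ {l₁ l₂} → mapLabel l₁ ≡ mapLabel l₂ → l₁ ≡ l₂
  mapLabel-injective {l₁} {l₂} eq = label-≡ X (liftφ-injective
    (trans (sym (underlying-mapLabel l₁)) (trans (cong (underlying X') eq) (underlying-mapLabel l₂))))

  preimage : ∀ l' → ∃ λ l → mapLabel l ≡ l'
  preimage (inj₁ ((x' , y' , r') , t))
    with x , refl ← strictlySurjective x' | y , refl ← strictlySurjective y' | r , refl ← strictlySurjective r' =
    inj₁ ((x , y , r) , subst T
      (cong₂ _∧_ (inSk-pres x) (cong₂ _∧_ (inSk-pres y) (cong₂ _∧_ (sim-pres x y) (prodB-pres x y r)))) t) ,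
    label-≡ X' refl
  preimage (inj₂ (x' , t)) with x , refl ← strictlySurjective x' =
    inj₂ (x , subst T (cong₂ _∧_ (inSk-pres x) (cong not (sim-pres x x))) t) , label-≡ X' refl

  mapLabel-surjective : ∀ l' → ∃ λ l → ∀ {l₁} → l₁ ≡ l → mapLabel l₁ ≡ l'
  mapLabel-surjective l' = let l , eq = preimage l' in l , λ { refl → eq }

  -- The inclusion in `r` informs only about actual pairs of `X`, so `β' γ'` is first dropped to a
  -- pair in the relation labelled `l`.
  colour-pres : ∀ α α' l r → (∀ β γ → T (mrel X α l β γ) → CC.col X β γ ≡ r) →
    ∀ β' γ' → T (mrel X' α' (mapLabel l) β' γ') → CC.col X' β' γ' ≡ AlgIso._′ Φ r
  colour-pres α α' l r l⊆r β' γ' h =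
    let β , αβ , _  = drop (same-refl α α') β'
        γ , αγ , βγ = drop αβ γ'
    in trans βγ (cong (AlgIso._′ Φ) (l⊆r β γ (subst T (sym (mrel-pres l αβ αγ βγ)) h)))

  mcount-pres : ∀ {α α'} a b d β ε β' ε' → T (mrel X α d β ε) → T (mrel X' α' (mapLabel d) β' ε') →
    mcount X α a b β ε ≡ mcount X' α' (mapLabel a) (mapLabel b) β' ε'
  mcount-pres {α} {α'} a b d β ε β' ε' dβε dβε' = ≤1-antisym
    (mcount≤1 X homogeneous a b) (mcount≤1 X' homogeneous′ (mapLabel a) (mapLabel b)) forward backward
    where
    αβ = proj₁ (mrel-same d dβε dβε')
    αε = proj₁ (proj₂ (mrel-same d dβε dβε'))
    βε = proj₂ (proj₂ (mrel-same d dβε dβε'))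

    forward : 0 < mcount X α a b β ε → 0 < mcount X' α' (mapLabel a) (mapLabel b) β' ε'
    forward h =
      let γ , aβγ , bγε = mcount⁻ X a b h
          γ' , ε₁ , αγ , αε₁ , βγ , βε₁ , γε₁ = transport 1<k cond αβ γ ε
          -- The transported `ε₁` could a priori differ from `ε'`, but both are the partner of `β'`
          -- under `mapLabel d`.
          ε₁≡ε' = mrel-functional X' homogeneous′ (mapLabel d)
                    (subst T (mrel-pres d αβ αε₁ βε₁) dβε) dβε'
      in mcount⁺ X' (mapLabel a) (mapLabel b) γ' (subst T (mrel-pres a αβ αγ βγ) aβγ)
           (subst (λ ζ → T (mrel X' α' (mapLabel b) γ' ζ)) ε₁≡ε' (subst T (mrel-pres b αγ αε₁ γε₁) bγε))

    backward : 0 < mcount X' α' (mapLabel a) (mapLabel b) β' ε' → 0 < mcount X α a b β ε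
    backward h =
      let γ' , aβγ' , bγε' = mcount⁻ X' (mapLabel a) (mapLabel b) h
          γ , αγ , βγ = drop αβ γ'
          aβγ = subst T (sym (mrel-pres a αβ αγ βγ)) aβγ'
          ε₁ , αε₁ , γε₁ = drop αγ ε'
          bγε₁ = subst T (sym (mrel-pres b αγ αε₁ γε₁)) bγε'
          -- Dropping has matched every edge except `β ε₁`. Transporting `γ` and `ε₁` gives points
          -- that the matchings identify with `γ'` and `ε'`, and this supplies the missing edge.
          γ₂ , ε₂ , αγ₂ , αε₂ , βγ₂ , βε₂ , γε₂ = transport 1<k cond αβ γ ε₁
          γ₂≡γ' = mrel-functional X' homogeneous′ (mapLabel a)
                    (subst T (mrel-pres a αβ αγ₂ βγ₂) aβγ) aβγ'
          ε₂≡ε' = mrel-functional X' homogeneous′ (mapLabel b)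
                    (subst (λ ζ → T (mrel X' α' (mapLabel b) ζ ε₂)) γ₂≡γ'
                      (subst T (mrel-pres b αγ₂ αε₂ γε₂) bγε₁)) bγε'
          βε₁ = subst (Same β ε₁ β') ε₂≡ε' βε₂
          -- With that edge known, `ε₁` and `ε` are both the partner of `β` under `d`.
          ε₁≡ε = mrel-functional X homogeneous d (subst T (sym (mrel-pres d αβ αε₁ βε₁)) dβε') dβε
      in mcount⁺ X a b γ aβγ (subst (λ ζ → T (mrel X α b γ ζ)) ε₁≡ε bγε₁)
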